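{- Let $q$ be a prime power. There is a one-to-one correspondence between the sets of complete mappings of any pair of isotopic polynomials in $\mathcal{LP}_q$. More precisely, if $(h_1,h_2,h_3)$ is an isotopism from a polynomial $f_1\in\mathcal{LP}_q$ to a polynomial $f_2\in\mathcal{LP}_q$, then $g\in\mathcal{P}_q$ is a complete mapping of $f_1$ if and only if $h_2gh_1^{ -1}\in\mathcal{P}_q$ is a complete mapping of $f_2$.
   Context: $\mathbb{F}_q$ is the finite field with $q$ elements. $\mathcal{P}_q$ is the set of polynomials in $\mathbb{F}_q[x]$ of degree less than $q$ that act as permutations of $\mathbb{F}_q$; for $f,g\in\mathcal{P}_q$, $fg:=f(g(x))$ modulo $x^q-x$, and $f^{ -1}\in\mathcal{P}_q$ is the inverse for this composition. $\mathcal{LP}_q$ is the set of polynomials $f\in\mathbb{F}_q[x,y]$ of degree less than $q$ in each variable such that, for every $a\in\mathbb{F}_q$, both $f(x,a)$ and $f(a,x)$ act as permutations of $\mathbb{F}_q$. An isotopism from $f_1\in\mathcal{LP}_q$ to $f_2\in\mathcal{LP}_q$ is a triple $(h_1,h_2,h_3)\in\mathcal{P}_q^3$ such that $f_2(h_1(x),h_2(y))=h_3(f_1(x,y))$ modulo $x^q-x$ and $y^q-y$; then $f_1$ and $f_2$ are isotopic. For $f\in\mathcal{LP}_q$ and $g_1,g_2\in\mathcal{P}_q$, put $\odot_f(g_1,g_2):=f(g_1(x),g_2(x))\in\mathbb{F}_q[x]$, taken modulo $x^q-x$. A polynomial $g\in\mathcal{P}_q$ is a complete mapping of $f\in\mathcal{LP}_q$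 if $\odot_f(x,g)\in\mathcal{P}_q$. -}

module Defs where

open import Algebra.Apartness.Bundles using (HeytingField; HeytingCommutativeRing)
open import Algebra.Bundles using (CommutativeRing)
open import Algebra.Bundles.Raw using (RawRing)
import Algebra.Definitions.RawSemiring as RawSemiringDefinitions
open import Data.Fin.Base using (Fin)
open import Data.List.Base using (List; []; _∷_; map)
open import Data.Nat.Base as ℕ using (ℕ; zero; suc)
open import Data.Nat.Primality using (Prime)
open import Data.Product.Base using (∃-syntax; _×_; proj₁)
open import Data.Sum.Base using (_⊎_)
open import Function.Bundles using (Inverse)
open import Function.Definitions using (Bijective)
open import Level using (Level; _⊔_)
open import Relation.Binary.Bundles using (Setoid)
import Relation.Binary.Construct.On as On
open import Relation.Binary.PropositionalEquality.Core using (_≡_)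
open import Relation.Binary.PropositionalEquality.Properties as ≡ using ()
open import Relation.Unary using (Pred; _∈_)

IsPrimePower : ℕ → Set
IsPrimePower q = ∃[ p ] ∃[ k ] (Prime p × 1 ℕ.≤ k × q ≡ p ℕ.^ k)

-- The enumeration makes _≈_ decidable, so the apartness x # y of the
-- Heyting field is equivalent to ¬ (x ≈ y) and the field is a field in the
-- ordinary sense.
record FiniteField c ℓ₁ ℓ₂ (q : ℕ) : Set (Level.suc (c ⊔ ℓ₁ ⊔ ℓ₂)) where
  field
    heytingField : HeytingField c ℓ₁ ℓ₂

  open HeytingField heytingField public using (heytingCommutativeRing)
  open HeytingCommutativeRing heytingCommutativeRing public using (commutativeRing)
  open CommutativeRing commutativeRing public

  field
    enumeration : Inverse setoid (≡.setoid (Fin q))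

------------------------------------------------------------------------
-- Polynomials in one variable over R, as lists of coefficients with the
-- constant coefficient first.  Trailing zeros are allowed; _≈ₚ_ ignores them.

module Polynomial {c ℓ} (R : RawRing c ℓ) where
  open RawRing R

  Poly : Set c
  Poly = List Carrier

  coeff : Poly → ℕ → Carrier
  coeff []      _       = 0#
  coeff (a ∷ p) zero    = a
  coeff (a ∷ p) (suc i) = coeff p i

  infix 4 _≈ₚ_
  _≈ₚ_ : Poly → Poly → Set ℓ
  p ≈ₚ r = ∀ i → coeff p i ≈ coeff r i

  infixl 6 _+ₚ_
  _+ₚ_ : Poly → Poly → Poly
  []      +ₚ r       = r
  (a ∷ p) +ₚ []      = a ∷ p
  (a ∷ p) +ₚ (b ∷ r) = (a + b) ∷ (p +ₚ r)

  infixl 7 _*ₚ_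
  _*ₚ_ : Poly → Poly → Poly
  []      *ₚ r = []
  (a ∷ p) *ₚ r = map (a *_) r +ₚ (0# ∷ (p *ₚ r))

  const : Carrier → Poly
  const a = a ∷ []

  X : Poly
  X = 0# ∷ 1# ∷ []

  rawRing : RawRing c ℓ
  rawRing = record
    { Carrier = Poly
    ; _≈_     = _≈ₚ_
    ; _+_     = _+ₚ_
    ; _*_     = _*ₚ_
    ; -_      = map (-_)
    ; 0#      = []
    ; 1#      = const 1#
    }

  -- p(s) for s in a ring S, where R acts on S through ι.
  substitute : ∀ {d m} (S : RawRing d m) → (Carrier → RawRing.Carrier S) →
               Poly → RawRing.Carrier S → RawRing.Carrier S
  substitute S ι []      s = RawRing.0# S
  substitute S ι (a ∷ p) s = ι a S.+ (s S.* substitute S ι p s)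
    where module S = RawRing S

------------------------------------------------------------------------

module PermutationPolynomials {c ℓ₁ ℓ₂ q} (𝔽 : FiniteField c ℓ₁ ℓ₂ q) where
  open FiniteField 𝔽 using (Carrier; _≈_; 0#; refl; sym; trans)

  𝔽-raw : RawRing c ℓ₁
  𝔽-raw = CommutativeRing.rawRing (FiniteField.commutativeRing 𝔽)

  module 𝔽[x] = Polynomial 𝔽-raw

  -- 𝔽[x,y] is 𝔽[x][y]: the coefficient of xⁱyʲ in f is coeff (coeff f j) i.
  module 𝔽[x,y] = Polynomial 𝔽[x].rawRing

  UPoly BPoly : Set c
  UPoly = 𝔽[x].Poly
  BPoly = 𝔽[x,y].Poly

  open 𝔽[x] public using (_≈ₚ_)

  x : UPoly
  x = 𝔽[x].X

  X Y : BPoly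
  X = 𝔽[x,y].const x
  Y = 𝔽[x,y].X

  xq-x : UPoly
  xq-x = (x ^ q) 𝔽[x].+ₚ (R.- x)
    where
    module R = RawRing 𝔽[x].rawRing
    open RawSemiringDefinitions R.rawSemiring using (_^_)

  Xq-X Yq-Y : BPoly
  Xq-X = 𝔽[x,y].const xq-x
  Yq-Y = (Y ^ q) 𝔽[x,y].+ₚ (R.- Y)
    where
    module R = RawRing 𝔽[x,y].rawRing
    open RawSemiringDefinitions R.rawSemiring using (_^_)

  polySetoid : Setoid c ℓ₁
  polySetoid = record
    { Carrier       = UPoly
    ; _≈_           = _≈ₚ_
    ; isEquivalence = record
      { refl  = λ i → refl
      ; sym   = λ p≈r i → sym (p≈r i)
      ; trans = λ p≈r r≈s i → trans (p≈r i) (r≈s i)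
      }
    }

  -- f(a), f(g(x)), f(g₁(x),g₂(x)), and f(s) for s in 𝔽[x,y].

  value : UPoly → Carrier → Carrier
  value = 𝔽[x].substitute 𝔽-raw (λ a → a)

  infix 9 _⟨_⟩ _⟨_,_⟩
  _⟨_⟩ : UPoly → UPoly → UPoly
  f ⟨ g ⟩ = 𝔽[x].substitute 𝔽[x].rawRing 𝔽[x].const f g

  _⟨_,_⟩ : BPoly → UPoly → UPoly → UPoly
  f ⟨ g₁ , g₂ ⟩ = 𝔽[x,y].substitute 𝔽[x].rawRing (_⟨ g₁ ⟩) f g₂

  substitute₁ : UPoly → BPoly → BPoly
  substitute₁ = 𝔽[x].substitute 𝔽[x,y].rawRing (λ a → 𝔽[x,y].const (𝔽[x].const a))

  substitute₂ : BPoly → BPoly → BPoly → BPoly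
  substitute₂ f s t = 𝔽[x,y].substitute 𝔽[x,y].rawRing (λ p → substitute₁ p s) f t

  -- The remainder of long division by the monic polynomial x^q - x (of
  -- degree q, as q ≥ 2 in a field): if r is the remainder of p, the
  -- remainder of a + x·p is a + x·r - t·(x^q - x), with t the coefficient
  -- of x^q in a + x·r.
  reduce : UPoly → UPoly
  reduce []      = []
  reduce (a ∷ p) = s R.+ (R.- (𝔽[x].const (𝔽[x].coeff s q) R.* xq-x))
    where
    module R = RawRing 𝔽[x].rawRing
    s = a ∷ reduce p

  -- The two sides agree modulo the ideal (x^q - x , y^q - y) of 𝔽[x,y].
  infix 4 _≡_mod[xq-x,yq-y]
  _≡_mod[xq-x,yq-y] : BPoly → BPoly → Set (c ⊔ ℓ₁)
  f ≡ g mod[xq-x,yq-y] =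
    ∃[ u ] ∃[ v ] f R.≈ g R.+ (u R.* Xq-X R.+ v R.* Yq-Y)
    where module R = RawRing 𝔽[x,y].rawRing

  ActsAsPermutation : Pred UPoly (c ⊔ ℓ₁)
  ActsAsPermutation f = Bijective _≈_ _≈_ (value f)

  𝒫 : Pred UPoly (c ⊔ ℓ₁)
  𝒫 f = (∀ i → q ℕ.≤ i → 𝔽[x].coeff f i ≈ 0#) × ActsAsPermutation f

  ℒ𝒫 : Pred BPoly (c ⊔ ℓ₁)
  ℒ𝒫 f =
    (∀ i j → q ℕ.≤ i ⊎ q ℕ.≤ j → 𝔽[x].coeff (𝔽[x,y].coeff f j) i ≈ 0#) ×
    (∀ a → ActsAsPermutation (f ⟨ x , 𝔽[x].const a ⟩) ×
           ActsAsPermutation (f ⟨ 𝔽[x].const a , x ⟩))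

  infixl 8 _∙_
  _∙_ : UPoly → UPoly → UPoly
  f ∙ g = reduce (f ⟨ g ⟩)

  -- Two-sided inverses in 𝒫 are unique up to _≈ₚ_.
  IsInverseOf : UPoly → UPoly → Set (c ⊔ ℓ₁)
  IsInverseOf f⁻¹ f = f⁻¹ ∈ 𝒫 × f⁻¹ ∙ f ≈ₚ x × f ∙ f⁻¹ ≈ₚ x

  record IsIsotopism (f₁ f₂ : BPoly) (h₁ h₂ h₃ : UPoly) : Set (c ⊔ ℓ₁) where
    field
      h₁∈𝒫     : h₁ ∈ 𝒫
      h₂∈𝒫     : h₂ ∈ 𝒫
      h₃∈𝒫     : h₃ ∈ 𝒫
      isotopic : substitute₂ f₂ (substitute₁ h₁ X) (substitute₁ h₂ Y)
                 ≡ substitute₁ h₃ f₁ mod[xq-x,yq-y]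

  Isotopic : BPoly → BPoly → Set (c ⊔ ℓ₁)
  Isotopic f₁ f₂ = ∃[ h₁ ] ∃[ h₂ ] ∃[ h₃ ] IsIsotopism f₁ f₂ h₁ h₂ h₃

  ⊙ : BPoly → UPoly → UPoly → UPoly
  ⊙ f g₁ g₂ = reduce (f ⟨ g₁ , g₂ ⟩)

  IsCompleteMapping : BPoly → Pred UPoly (c ⊔ ℓ₁)
  IsCompleteMapping f g = g ∈ 𝒫 × ⊙ f x g ∈ 𝒫

  CompleteMappings : BPoly → Setoid (c ⊔ ℓ₁) ℓ₁
  CompleteMappings f =
    On.setoid {B = ∃[ g ] IsCompleteMapping f g} polySetoid proj₁

{-# OPTIONS --safe #-}

-- Evaluation at points is a ring homomorphism killing x^q − x and y^q − y (by
-- Fermat's a^q = a), and a polynomial of degree less than q is determined by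
-- its values, so everything can be checked pointwise.  There the isotopism
-- says f₂(h₁ a, h₂ b) = h₃ (f₁(a, b)); for g′ = h₂ g h₁⁻¹ and b = g a this
-- reads f₂(h₁ a, g′ (h₁ a)) = h₃ (f₁(a, g a)), so that a ↦ f₂(a, g′ a) is a
-- permutation exactly when a ↦ f₁(a, g a) is.  Inverses of permutations are
-- realised by polynomials through interpolation.

module Submission where

open import Defs
open import Algebra.Apartness.Bundles using (HeytingField)
import Algebra.Apartness.Properties.HeytingCommutativeRing as ApartnessProperties
open import Algebra.Bundles using (CommutativeMonoid; CommutativeRing)
open import Algebra.Bundles.Raw using (RawRing)
import Algebra.Definitions.RawMonoid as RawMonoidDefinitions
import Algebra.Definitions.RawSemiring as RawSemiringDefinitions
import Algebra.Morphism.Construct.Identity as Identity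
open import Algebra.Morphism.Structures using (module RingMorphisms)
import Algebra.Properties.AbelianGroup as AbelianGroupProperties
import Algebra.Properties.CommutativeMonoid.Sum as CommutativeMonoidSum
import Algebra.Properties.Group as GroupProperties
import Algebra.Properties.Ring as RingProperties
import Algebra.Properties.Semiring.Exp as SemiringExp
import Algebra.Solver.Ring.NaturalCoefficients.Default as SemiringSolver
open import Data.Fin.Base using (Fin; zero; suc; punchIn)
import Data.Fin.Permutation as Permutation
open import Data.Fin.Properties as Fin using (any?; punchInᵢ≢i)
open import Data.List.Base using ([]; _∷_; map)
open import Data.Nat.Base as ℕ using (ℕ; zero; suc; z≤n; s≤s)
import Data.Nat.Properties as ℕ
open import Data.Product.Base using (Σ-syntax; ∃-syntax; _×_; _,_; proj₁; proj₂)
open import Data.Sum.Base using (_⊎_; inj₁; inj₂)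
open import Function.Base using (_∘_)
open import Function.Bundles using (Bijection; Equivalence; Inverse; _⇔_; mk⇔)
import Function.Construct.Composition as Composition
open import Function.Definitions using (Bijective)
open import Function.Properties.Inverse using (Inverse⇒Injection)
open import Relation.Binary.Definitions using (Decidable)
open import Relation.Binary.PropositionalEquality.Core as ≡ using (_≡_; _≢_)
import Relation.Binary.Reasoning.Setoid as SetoidReasoning
open import Relation.Nullary.Decidable using (Dec; yes; no; via-injection)
open import Relation.Nullary.Negation using (contradiction)
open import Relation.Unary using (_∈_)

open RingMorphisms using (IsRingHomomorphism)

-- Polynomials are coefficient lists with trailing zeros allowed, and the polynomial rings enter
-- only as raw rings. All algebra therefore takes place in the field, after evaluation. An element
-- of 𝔽[x,y] is a polynomial in y over 𝔽[x], so evaluation at a point (a, b) is one-variable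
-- evaluation carried out twice, and one homomorphism lemma with an arbitrary coefficient map serves
-- both levels. The way back from values to coefficients is needed in one variable only: for the
-- inverse polynomials, and for the correspondence of complete mappings, whose equality is `_≈ₚ_`.
-- Every composite ends with `reduce`, which keeps values and forces degree below q; this is what
-- makes composites eligible for that way back. The converse half of the equivalence comes from
-- solving the pointwise identity for the values of f₁ by means of h₃⁻¹.

-- Substitution into polynomials as a ring homomorphism.

module _ {c ℓ d m} (R : RawRing c ℓ) (S : CommutativeRing d m) where
  private
    module R = RawRing R
    module S = CommutativeRing S
    module R^ = RawSemiringDefinitions R.rawSemiring
    module S^ = RawSemiringDefinitions (RawRing.rawSemiring S.rawRing)

  ^-homo : ∀ {φ} → IsRingHomomorphism R S.rawRing φ →
           ∀ a n → φ (a R^.^ n) S.≈ φ a S^.^ n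
  ^-homo φ-homo a zero    = IsRingHomomorphism.1#-homo φ-homo
  ^-homo φ-homo a (suc n) =
    S.trans (IsRingHomomorphism.*-homo φ-homo _ _) (S.*-congˡ (^-homo φ-homo a n))

-- R is only assumed to be a raw ring, so that the lemmas apply to
-- R = 𝔽[x] without a proof that 𝔽[x] is a ring.
module Substitution {c ℓ d m} {R : RawRing c ℓ} (S : CommutativeRing d m) where
  private
    module R = RawRing R
    module R[x] = Polynomial R
    open CommutativeRing S
    open RingProperties ring using (-‿distribʳ-*; -‿+-comm; -0#≈0#)
    open SetoidReasoning setoid
    open SemiringSolver commutativeSemiring using (solve; _:+_; _:*_; _:=_; con)

  -- The coefficient map varies too, because pushing a homomorphism through a substitution yields a
  -- composite coefficient map that agrees with the intended one only up to `_≈_`.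
  substitute-cong : ∀ {ι ι′ : R.Carrier → Carrier} → (∀ a → ι a ≈ ι′ a) →
                    ∀ p {s s′} → s ≈ s′ →
                    R[x].substitute rawRing ι p s ≈ R[x].substitute rawRing ι′ p s′
  substitute-cong ι≈ []      s≈ = refl
  substitute-cong ι≈ (a ∷ p) s≈ = +-cong (ι≈ a) (*-cong s≈ (substitute-cong ι≈ p s≈))

  -- Horner's scheme uses only zero, sums and products. With `φ` an evaluation, this turns
  -- substitution of polynomials into composition of functions.
  substitute-homo : ∀ {e n} {T : RawRing e n} {φ} → IsRingHomomorphism T rawRing φ →
                    ∀ {ι : R.Carrier → RawRing.Carrier T} p t →
                    φ (R[x].substitute T ι p t) ≈ R[x].substitute rawRing (φ ∘ ι) p (φ t)
  substitute-homo φ-homo []      t = IsRingHomomorphism.0#-homo φ-homo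
  substitute-homo φ-homo (a ∷ p) t =
    trans (φ.+-homo _ _) (+-congˡ (trans (φ.*-homo _ _) (*-congˡ (substitute-homo φ-homo p t))))
    where module φ = IsRingHomomorphism φ-homo

  module _ {ι : R.Carrier → Carrier} (ι-homo : IsRingHomomorphism R rawRing ι)
           (s : Carrier) where
    private
      module ι = IsRingHomomorphism ι-homo
      ⟦_⟧ : R[x].Poly → Carrier
      ⟦ p ⟧ = R[x].substitute rawRing ι p s

    substitute-const : ∀ a → ⟦ R[x].const a ⟧ ≈ ι a
    substitute-const a = trans (+-congˡ (zeroʳ s)) (+-identityʳ (ι a))

    substitute-X : ⟦ R[x].X ⟧ ≈ s
    substitute-X = begin
      ι R.0# + s * ⟦ R[x].const R.1# ⟧
        ≈⟨ +-cong ι.0#-homo (*-congˡ (trans (substitute-const R.1#) ι.1#-homo)) ⟩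
      0# + s * 1#                      ≈⟨ +-identityˡ _ ⟩
      s * 1#                           ≈⟨ *-identityʳ s ⟩
      s                                ∎

    private
      shift-≈0 : ∀ {a p} → ι a ≈ 0# → ⟦ p ⟧ ≈ 0# → ⟦ a ∷ p ⟧ ≈ 0#
      shift-≈0 a≈0 p≈0 =
        trans (+-cong a≈0 (trans (*-congˡ p≈0) (zeroʳ s))) (+-identityˡ 0#)

      -- Equal polynomials may be lists of different lengths; in the mixed cases the surplus
      -- coefficients are all zero, so they contribute nothing to the value.
      ⟦⟧-cong : ∀ p r → p R[x].≈ₚ r → ⟦ p ⟧ ≈ ⟦ r ⟧
      ⟦⟧-cong []      []      p≈r = refl
      ⟦⟧-cong []      (b ∷ r) p≈r = sym (shift-≈0 {p = r}
        (trans (sym (ι.⟦⟧-cong (p≈r 0))) ι.0#-homo) (sym (⟦⟧-cong [] r (p≈r ∘ suc))))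
      ⟦⟧-cong (a ∷ p) []      p≈r = shift-≈0 {p = p}
        (trans (ι.⟦⟧-cong (p≈r 0)) ι.0#-homo) (⟦⟧-cong p [] (p≈r ∘ suc))
      ⟦⟧-cong (a ∷ p) (b ∷ r) p≈r =
        +-cong (ι.⟦⟧-cong (p≈r 0)) (*-congˡ (⟦⟧-cong p r (p≈r ∘ suc)))

      +-homo : ∀ p r → ⟦ p R[x].+ₚ r ⟧ ≈ ⟦ p ⟧ + ⟦ r ⟧
      +-homo []      r       = sym (+-identityˡ _)
      +-homo (a ∷ p) []      = sym (+-identityʳ _)
      +-homo (a ∷ p) (b ∷ r) = begin
        ι (a R.+ b) + s * ⟦ p R[x].+ₚ r ⟧       ≈⟨ +-cong (ι.+-homo a b) (*-congˡ (+-homo p r)) ⟩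
        (ι a + ι b) + s * (⟦ p ⟧ + ⟦ r ⟧)
          ≈⟨ solve 5
               (λ a b s p r → (a :+ b) :+ s :* (p :+ r) := (a :+ s :* p) :+ (b :+ s :* r))
               refl (ι a) (ι b) s ⟦ p ⟧ ⟦ r ⟧ ⟩
        (ι a + s * ⟦ p ⟧) + (ι b + s * ⟦ r ⟧)   ∎

      scale-homo : ∀ a r → ⟦ map (a R.*_) r ⟧ ≈ ι a * ⟦ r ⟧
      scale-homo a []      = sym (zeroʳ (ι a))
      scale-homo a (b ∷ r) = begin
        ι (a R.* b) + s * ⟦ map (a R.*_) r ⟧ ≈⟨ +-cong (ι.*-homo a b) (*-congˡ (scale-homo a r)) ⟩
        ι a * ι b + s * (ι a * ⟦ r ⟧)
          ≈⟨ solve 4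
               (λ a b s r → a :* b :+ s :* (a :* r) := a :* (b :+ s :* r))
               refl (ι a) (ι b) s ⟦ r ⟧ ⟩
        ι a * (ι b + s * ⟦ r ⟧)              ∎

      *-homo : ∀ p r → ⟦ p R[x].*ₚ r ⟧ ≈ ⟦ p ⟧ * ⟦ r ⟧
      *-homo []      r = sym (zeroˡ _)
      *-homo (a ∷ p) r = begin
        ⟦ map (a R.*_) r R[x].+ₚ (R.0# ∷ p R[x].*ₚ r) ⟧     ≈⟨ +-homo (map (a R.*_) r) _ ⟩
        ⟦ map (a R.*_) r ⟧ + (ι R.0# + s * ⟦ p R[x].*ₚ r ⟧)
          ≈⟨ +-cong (scale-homo a r) (+-cong ι.0#-homo (*-congˡ (*-homo p r))) ⟩
        ι a * ⟦ r ⟧ + (0# + s * (⟦ p ⟧ * ⟦ r ⟧))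
          ≈⟨ solve 4
               (λ a s p r → a :* r :+ (con 0 :+ s :* (p :* r)) := (a :+ s :* p) :* r)
               refl (ι a) s ⟦ p ⟧ ⟦ r ⟧ ⟩
        (ι a + s * ⟦ p ⟧) * ⟦ r ⟧                           ∎

      neg-homo : ∀ p → ⟦ map R.-_ p ⟧ ≈ - ⟦ p ⟧
      neg-homo []      = sym -0#≈0#
      neg-homo (a ∷ p) = begin
        ι (R.- a) + s * ⟦ map R.-_ p ⟧ ≈⟨ +-cong (ι.-‿homo a) (*-congˡ (neg-homo p)) ⟩
        - ι a + s * - ⟦ p ⟧            ≈⟨ +-congˡ (-‿distribʳ-* s ⟦ p ⟧) ⟨
        - ι a + - (s * ⟦ p ⟧)          ≈⟨ -‿+-comm (ι a) (s * ⟦ p ⟧) ⟩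
        - (ι a + s * ⟦ p ⟧)            ∎

    -- The freedom in `ι` permits iteration: the identity gives evaluation of 𝔽[x] at a, and taking
    -- that evaluation as the new `ι` gives evaluation of 𝔽[x,y] at (a, b).
    substitute-isRingHomomorphism :
      IsRingHomomorphism R[x].rawRing rawRing (λ p → R[x].substitute rawRing ι p s)
    substitute-isRingHomomorphism = record
      { isSemiringHomomorphism = record
        { isNearSemiringHomomorphism = record
          { +-isMonoidHomomorphism = record
            { isMagmaHomomorphism = record
              { isRelHomomorphism = record { cong = λ {p r} → ⟦⟧-cong p r }
              ; homo              = +-homo
              }
            ; ε-homo = refl
            }
          ; *-homo = *-homo
          }
        ; 1#-homo = trans (substitute-const R.1#) ι.1#-homo
        }
      ; -‿homo = neg-homo
      }

-- Coefficients of sums, scalar multiples and powers of x.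

module Coefficients {c ℓ} (R : CommutativeRing c ℓ) where
  open CommutativeRing R
  open RingProperties ring using (-0#≈0#)
  open Polynomial rawRing hiding (rawRing)
  open RawSemiringDefinitions (RawRing.rawSemiring (Polynomial.rawRing rawRing)) using (_^_)
  open SetoidReasoning setoid

  coeff-+ : ∀ p r i → coeff (p +ₚ r) i ≈ coeff p i + coeff r i
  coeff-+ []      r       i       = sym (+-identityˡ _)
  coeff-+ (a ∷ p) []      i       = sym (+-identityʳ _)
  coeff-+ (a ∷ p) (b ∷ r) zero    = refl
  coeff-+ (a ∷ p) (b ∷ r) (suc i) = coeff-+ p r i

  -- Past the end of the list both sides read a default `0#`, which `f` has to preserve.
  coeff-map : ∀ {f} → f 0# ≈ 0# → ∀ p i → coeff (map f p) i ≈ f (coeff p i)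
  coeff-map f0≈0 []      i       = sym f0≈0
  coeff-map f0≈0 (a ∷ p) zero    = refl
  coeff-map f0≈0 (a ∷ p) (suc i) = coeff-map f0≈0 p i

  coeff-∸ : ∀ p r i → coeff (p +ₚ map -_ r) i ≈ coeff p i - coeff r i
  coeff-∸ p r i = trans (coeff-+ p (map -_ r) i) (+-congˡ (coeff-map -0#≈0# r i))

  coeff-const-* : ∀ a p i → coeff (const a *ₚ p) i ≈ a * coeff p i
  coeff-const-* a p i = begin
    coeff (map (a *_) p +ₚ const 0#) i        ≈⟨ coeff-+ (map (a *_) p) (const 0#) i ⟩
    coeff (map (a *_) p) i + coeff (const 0#) i ≈⟨ +-cong (coeff-map (zeroʳ a) p i) (coeff-const-0 i) ⟩
    a * coeff p i + 0#                        ≈⟨ +-identityʳ _ ⟩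
    a * coeff p i                             ∎
    where
    coeff-const-0 : ∀ i → coeff (const 0#) i ≈ 0#
    coeff-const-0 zero    = refl
    coeff-const-0 (suc i) = refl

  coeff-X-* : ∀ p i → coeff (X *ₚ p) (suc i) ≈ coeff p i
  coeff-X-* p i = begin
    coeff (X *ₚ p) (suc i)                                   ≈⟨ coeff-+ (map (0# *_) p) _ (suc i) ⟩
    coeff (map (0# *_) p) (suc i) + coeff (const 1# *ₚ p) i
      ≈⟨ +-cong (trans (coeff-map (zeroʳ 0#) p (suc i)) (zeroˡ _)) (coeff-const-* 1# p i) ⟩
    0# + 1# * coeff p i                                      ≈⟨ +-identityˡ _ ⟩
    1# * coeff p i                                           ≈⟨ *-identityˡ _ ⟩
    coeff p i                                                ∎

  -- With the next lemma, this makes x^q - x monic of degree q, so that subtracting multiples of it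
  -- can remove a leading term.
  coeff-X^n-n : ∀ n → coeff (X ^ n) n ≈ 1#
  coeff-X^n-n zero    = refl
  coeff-X^n-n (suc n) = trans (coeff-X-* (X ^ n) n) (coeff-X^n-n n)

  coeff-X^n-> : ∀ n {i} → n ℕ.< i → coeff (X ^ n) i ≈ 0#
  coeff-X^n-> zero    (s≤s _)   = refl
  coeff-X^n-> (suc n) (s≤s n<i) = trans (coeff-X-* (X ^ n) _) (coeff-X^n-> n n<i)

-- Division by a linear factor.

module SyntheticDivision {c ℓ} (R : CommutativeRing c ℓ) where
  open CommutativeRing R
  open Polynomial rawRing hiding (rawRing)
  open SetoidReasoning setoid
  open SemiringSolver commutativeSemiring using (solve; _:+_; _:*_; _:=_)

  private
    ⟦_⟧ : Poly → Carrier → Carrier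
    ⟦_⟧ = substitute rawRing (λ a → a)

    vanish : ∀ p → p ≈ₚ [] → ∀ b → ⟦ p ⟧ b ≈ 0#
    vanish []      p≈0 b = refl
    vanish (a ∷ p) p≈0 b = begin
      a + b * ⟦ p ⟧ b ≈⟨ +-cong (p≈0 0) (*-congˡ (vanish p (p≈0 ∘ suc) b)) ⟩
      0# + b * 0#     ≈⟨ +-identityˡ _ ⟩
      b * 0#          ≈⟨ zeroʳ b ⟩
      0#              ∎

  -- Ruffini's rule: the coefficients of (p - p(b)) / (x - b) are the values at b of the successive
  -- proper tails of p.
  quotient : Poly → Carrier → Poly
  quotient []      b = []
  quotient (a ∷ p) b = ⟦ p ⟧ b ∷ quotient p b

  -- Here d stands for y − b, so that only semiring identities are needed.
  division : ∀ p {b y d} → y ≈ b + d → ⟦ p ⟧ y ≈ ⟦ p ⟧ b + d * ⟦ quotient p b ⟧ y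
  division []      {d = d} y≈ = sym (trans (+-identityˡ _) (zeroʳ d))
  division (a ∷ p) {b} {y} {d} y≈ = begin
    a + y * ⟦ p ⟧ y
      ≈⟨ +-congˡ (*-congˡ (division p y≈)) ⟩
    a + y * (⟦ p ⟧ b + d * q)
      ≈⟨ solve 5
           (λ a y p d q → a :+ y :* (p :+ d :* q) := a :+ (y :* p :+ d :* (y :* q)))
           refl a y (⟦ p ⟧ b) d q ⟩
    a + (y * ⟦ p ⟧ b + d * (y * q))                                  ≈⟨ +-congˡ (+-congʳ (*-congʳ y≈)) ⟩
    a + ((b + d) * ⟦ p ⟧ b + d * (y * q))
      ≈⟨ solve 6
           (λ a b y p d q → a :+ ((b :+ d) :* p :+ d :* (y :* q)) := (a :+ b :* p) :+ d :* (p :+ y :* q))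
           refl a b y (⟦ p ⟧ b) d q ⟩
    (a + b * ⟦ p ⟧ b) + d * (⟦ p ⟧ b + y * q)                        ∎
    where q = ⟦ quotient p b ⟧ y

  quotient-degree : ∀ p b {n} → (∀ i → suc n ℕ.≤ i → coeff p i ≈ 0#) →
                    ∀ i → n ℕ.≤ i → coeff (quotient p b) i ≈ 0#
  quotient-degree []      b         deg i       n≤i       = refl
  -- The tail `p` need not be the empty list here, but all its coefficients are zero, hence so is
  -- its value at `b`.
  quotient-degree (a ∷ p) b {zero}  deg zero    n≤i       = vanish p (λ i → deg (suc i) (s≤s z≤n)) b
  quotient-degree (a ∷ p) b {zero}  deg (suc i) n≤i       =
    quotient-degree p b (λ j _ → deg (suc j) (s≤s z≤n)) i z≤n
  quotient-degree (a ∷ p) b {suc n} deg (suc i) (s≤s n≤i) =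
    quotient-degree p b (λ j n<j → deg (suc j) (s≤s n<j)) i n≤i

  -- Each coefficient is the value at `b` of the tail it starts, minus `b` times the value of the
  -- next tail. Those values are p(b) and the entries of the quotient.
  quotient≈0⇒≈0 : ∀ p b → ⟦ p ⟧ b ≈ 0# → quotient p b ≈ₚ [] → p ≈ₚ []
  quotient≈0⇒≈0 []      b p[b]≈0 quo≈0 i    = refl
  quotient≈0⇒≈0 (a ∷ p) b p[b]≈0 quo≈0 zero = begin
    a               ≈⟨ +-identityʳ a ⟨
    a + 0#          ≈⟨ +-congˡ (zeroʳ b) ⟨
    a + b * 0#      ≈⟨ +-congˡ (*-congˡ (quo≈0 0)) ⟨
    a + b * ⟦ p ⟧ b ≈⟨ p[b]≈0 ⟩
    0#              ∎
  quotient≈0⇒≈0 (a ∷ p) b p[b]≈0 quo≈0 (suc i) =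
    quotient≈0⇒≈0 p b (quo≈0 0) (quo≈0 ∘ suc) i

-- Finite fields: inverses, Fermat's theorem and the number of roots.

module _ {c ℓ} (M : CommutativeMonoid c ℓ) where
  open CommutativeMonoid M
  open CommutativeMonoidSum M
  open RawMonoidDefinitions rawMonoid using () renaming (_×_ to _×ᴹ_)

  -- Used in the multiplicative monoid of the field, where the sum is a product over all elements,
  -- the exceptional index is that of 0, and the right-hand side is a^(q-1).
  sum-replicate-except : ∀ {n} (t : Fin n → Carrier) i a → t i ≈ ε →
                         (∀ {j} → j ≢ i → t j ≈ a) → sum t ≈ ℕ.pred n ×ᴹ a
  sum-replicate-except {suc n} t i a t[i]≈ε t≈a = begin
    sum t                      ≈⟨ sum-remove {i = i} t ⟩
    t i ∙ sum (t ∘ punchIn i)  ≈⟨ ∙-cong t[i]≈ε (sum-cong-≋ (λ j → t≈a (punchInᵢ≢i i j))) ⟩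
    ε ∙ sum {n} (λ _ → a)      ≈⟨ identityˡ _ ⟩
    sum {n} (λ _ → a)          ≈⟨ sum-replicate n ⟩
    n ×ᴹ a                     ∎
    where open SetoidReasoning setoid

module FiniteFieldProperties {c ℓ₁ ℓ₂ q} (𝔽 : FiniteField c ℓ₁ ℓ₂ q) where
  open FiniteField 𝔽 hiding (zero)
  open HeytingField heytingField using (tight; #⇒invertible)
  open ApartnessProperties heytingCommutativeRing using (1#0; x-0≈x)
  open GroupProperties +-group using (x∙y⁻¹≈ε⇒x≈y)
  open RawSemiringDefinitions (RawRing.rawSemiring rawRing) using (_^_)
  open Inverse enumeration using (to; from; to-cong; from-cong; strictlyInverseˡ; strictlyInverseʳ)
  open Polynomial rawRing hiding (rawRing)
  open SyntheticDivision commutativeRing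
  open SetoidReasoning setoid

  infix 4 _≟_
  _≟_ : Decidable _≈_
  _≟_ = via-injection (Inverse⇒Injection enumeration) Fin._≟_

  1≉0 : 1# ≉ 0#
  1≉0 1≈0 = proj₂ (tight 1# 0#) 1≈0 1#0

  -- This bound puts x itself below degree q and makes the exponent q - 1 positive. The helper
  -- generalises `q` to a variable so that it can be split into cases.
  1<q : 1 ℕ.< q
  1<q = 2≤size to λ to≡ → 1≉0 (trans (sym (strictlyInverseʳ 1#)) (trans (from-cong to≡) (strictlyInverseʳ 0#)))
    where
    2≤size : ∀ {n} (f : Carrier → Fin n) → f 1# ≢ f 0# → 1 ℕ.< n
    2≤size {zero}        f f≢ with () ← f 1#
    2≤size {suc zero}    f f≢ with f 1# | f 0#
    ... | zero | zero = contradiction ≡.refl f≢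
    2≤size {suc (suc _)} f f≢ = s≤s (s≤s z≤n)

  -- Tightness alone only gives ¬ ¬ (a has an inverse); the search through the
  -- enumeration removes the double negation.
  inverse : ∀ {a} → a ≉ 0# → ∃[ b ] a * b ≈ 1#
  inverse {a} a≉0 with any? (λ i → a * from i ≟ 1#)
  ... | yes (i , a*b≈1) = from i , a*b≈1
  ... | no ¬invertible  = contradiction (proj₁ (tight a 0#) ¬a#0) a≉0
    where
    ¬a#0 = λ a#0 → let b , _ , [a-0]*b≈1 = #⇒invertible a#0 in
      ¬invertible (to b , (begin
        a * from (to b) ≈⟨ *-cong (sym (x-0≈x a)) (strictlyInverseʳ b) ⟩
        (a - 0#) * b    ≈⟨ [a-0]*b≈1 ⟩
        1#              ∎))

  *-cancelˡ-inverse : ∀ {a b} → a * b ≈ 1# → ∀ c → b * (a * c) ≈ c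
  *-cancelˡ-inverse {a} {b} ab≈1 c = begin
    b * (a * c) ≈⟨ *-assoc b a c ⟨
    (b * a) * c ≈⟨ *-congʳ (*-comm b a) ⟩
    (a * b) * c ≈⟨ *-congʳ ab≈1 ⟩
    1# * c      ≈⟨ *-identityˡ c ⟩
    c           ∎

  *-zero-cancelˡ : ∀ {a c} → a ≉ 0# → a * c ≈ 0# → c ≈ 0#
  *-zero-cancelˡ {a} {c} a≉0 ac≈0 = let b , ab≈1 = inverse a≉0 in begin
    c           ≈⟨ *-cancelˡ-inverse ab≈1 c ⟨
    b * (a * c) ≈⟨ *-congˡ ac≈0 ⟩
    b * 0#      ≈⟨ zeroʳ b ⟩
    0#          ∎

  private
    module Π = CommutativeMonoidSum *-commutativeMonoid

    if-zero : ∀ {a} → Dec (a ≈ 0#) → Carrier → Carrier → Carrier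
    if-zero (yes _) c d = c
    if-zero (no _)  c d = d

    -- The product of the inverses inverts the product; this allows the product of the nonzero
    -- elements to be cancelled in Fermat's argument.
    invertible-product : ∀ {n} (t : Fin n → Carrier) → (∀ i → ∃[ b ] t i * b ≈ 1#) →
                         ∃[ b ] Π.sum t * b ≈ 1#
    invertible-product {n} t inv = Π.sum (proj₁ ∘ inv) , (begin
      Π.sum t * Π.sum (proj₁ ∘ inv)      ≈⟨ Π.∑-distrib-+ t (proj₁ ∘ inv) ⟨
      Π.sum (λ i → t i * proj₁ (inv i))  ≈⟨ Π.sum-cong-≋ (proj₂ ∘ inv) ⟩
      Π.sum {n} (λ _ → 1#)               ≈⟨ Π.sum-replicate-zero n ⟩
      1#                                 ∎)

  -- Multiplication by a permutes the nonzero elements, so their product P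
  -- satisfies P = a^(q-1) P.  The products run over the whole field, with the
  -- factor of 0 replaced by 1.
  fermat : ∀ {a} → a ≉ 0# → a ^ ℕ.pred q ≈ 1#
  fermat {a} a≉0 = begin
    a ^ ℕ.pred q
      ≈⟨ sum-replicate-except *-commutativeMonoid (factor ∘ from) (to 0#) a factor-0 factor-≉0 ⟨
    Π.sum (factor ∘ from)    ≈⟨ sym (*-identityʳ _) ⟩
    F * 1#                   ≈⟨ *-congˡ P*P⁻¹≈1 ⟨
    F * (P * P⁻¹)            ≈⟨ *-assoc F P P⁻¹ ⟨
    F * P * P⁻¹              ≈⟨ *-congʳ (Π.∑-distrib-+ (factor ∘ from) (unit ∘ from)) ⟨
    Π.sum (λ i → factor (from i) * unit (from i)) * P⁻¹
                             ≈⟨ *-congʳ (Π.sum-cong-≋ (λ i → unit-a* (from i))) ⟨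
    Π.sum (λ i → unit (a * from i)) * P⁻¹
                             ≈⟨ *-congʳ (Π.sum-cong-≋ (λ i → unit-cong (strictlyInverseʳ (a * from i)))) ⟨
    Π.sum (λ i → unit (from (to (a * from i)))) * P⁻¹
                             ≈⟨ *-congʳ (Π.sum-permute (unit ∘ from) π) ⟨
    P * P⁻¹                  ≈⟨ P*P⁻¹≈1 ⟩
    1#                       ∎
    where
    a⁻¹ = proj₁ (inverse a≉0)
    aa⁻¹≈1 = proj₂ (inverse a≉0)

    unit factor : Carrier → Carrier
    unit b   = if-zero (b ≟ 0#) 1# b
    factor b = if-zero (b ≟ 0#) 1# a

    unit-cong : ∀ {b c} → b ≈ c → unit b ≈ unit c
    unit-cong {b} {c} b≈c with b ≟ 0# | c ≟ 0#
    ... | yes _   | yes _   = refl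
    ... | yes b≈0 | no c≉0  = contradiction (trans (sym b≈c) b≈0) c≉0
    ... | no b≉0  | yes c≈0 = contradiction (trans b≈c c≈0) b≉0
    ... | no _    | no _    = b≈c

    unit-a* : ∀ b → unit (a * b) ≈ factor b * unit b
    unit-a* b with b ≟ 0# | a * b ≟ 0#
    ... | yes _   | yes _    = sym (*-identityˡ 1#)
    ... | yes b≈0 | no ab≉0  = contradiction (trans (*-congˡ b≈0) (zeroʳ a)) ab≉0
    ... | no b≉0  | yes ab≈0 = contradiction (*-zero-cancelˡ a≉0 ab≈0) b≉0
    ... | no _    | no _     = refl

    unit-invertible : ∀ b → ∃[ b⁻¹ ] unit b * b⁻¹ ≈ 1#
    unit-invertible b with b ≟ 0#
    ... | yes _  = 1# , *-identityˡ 1#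
    ... | no b≉0 = inverse b≉0

    factor-0 : factor (from (to 0#)) ≈ 1#
    factor-0 with from (to 0#) ≟ 0#
    ... | yes _  = refl
    ... | no ≉0  = contradiction (strictlyInverseʳ 0#) ≉0

    factor-≉0 : ∀ {i} → i ≢ to 0# → factor (from i) ≈ a
    factor-≉0 {i} i≢ with from i ≟ 0#
    ... | yes ≈0 = contradiction (≡.trans (≡.sym (strictlyInverseˡ i)) (to-cong ≈0)) i≢
    ... | no _   = refl

    P F P⁻¹ : Carrier
    P   = Π.sum (unit ∘ from)
    F   = Π.sum (factor ∘ from)
    P⁻¹ = proj₁ (invertible-product (unit ∘ from) (unit-invertible ∘ from))

    P*P⁻¹≈1 : P * P⁻¹ ≈ 1#
    P*P⁻¹≈1 = proj₂ (invertible-product (unit ∘ from) (unit-invertible ∘ from))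

    scaling-inverse : ∀ {b c} → b * c ≈ 1# → ∀ i → to (c * from (to (b * from i))) ≡ i
    scaling-inverse {b} {c} bc≈1 i = ≡.trans
      (to-cong (trans (*-congˡ (strictlyInverseʳ _)) (*-cancelˡ-inverse bc≈1 (from i))))
      (strictlyInverseˡ i)

    π : Permutation.Permutation q q
    π = Permutation.permutation (λ i → to (a * from i)) (λ i → to (a⁻¹ * from i))
      (scaling-inverse (trans (*-comm a⁻¹ a) aa⁻¹≈1)) (scaling-inverse aa⁻¹≈1)

  a^q≈a : ∀ a → a ^ q ≈ a
  a^q≈a a = trans (reflexive (≡.cong (a ^_) (≡.sym (suc-pred 1<q)))) (helper (a ≟ 0#))
    where
    suc-pred : ∀ {n} → 1 ℕ.< n → suc (ℕ.pred n) ≡ n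
    suc-pred (s≤s _) = ≡.refl

    helper : Dec (a ≈ 0#) → a * a ^ ℕ.pred q ≈ a
    helper (yes a≈0) = trans (*-congʳ a≈0) (trans (zeroˡ _) (sym a≈0))
    helper (no a≉0)  = trans (*-congˡ (fermat a≉0)) (*-identityʳ a)

  -- Induction on the number of points: dividing by x - b₀ lowers the degree bound by one, and the
  -- other points stay roots of the quotient because they differ from b₀ and there are no zero
  -- divisors.
  all-roots⇒≈0 : ∀ {n} (b : Fin n → Carrier) → (∀ {i j} → b i ≈ b j → i ≡ j) →
                 ∀ p → (∀ i → n ℕ.≤ i → coeff p i ≈ 0#) →
                 (∀ i → substitute rawRing (λ a → a) p (b i) ≈ 0#) → p ≈ₚ []
  all-roots⇒≈0 {zero}  b b-injective p deg roots i = deg i z≤n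
  all-roots⇒≈0 {suc n} b b-injective p deg roots =
    quotient≈0⇒≈0 p b₀ (roots zero)
      (all-roots⇒≈0 (b ∘ suc) (Fin.suc-injective ∘ b-injective) (quotient p b₀)
        (quotient-degree p b₀ deg) quotient-roots)
    where
    ⟦_⟧ = substitute rawRing (λ a → a)
    b₀ = b zero

    quotient-roots : ∀ i → ⟦ quotient p b₀ ⟧ (b (suc i)) ≈ 0#
    quotient-roots i = *-zero-cancelˡ y-b₀≉0 (begin
      (y - b₀) * ⟦ quotient p b₀ ⟧ y             ≈⟨ +-identityˡ _ ⟨
      0# + (y - b₀) * ⟦ quotient p b₀ ⟧ y        ≈⟨ +-congʳ (roots zero) ⟨
      ⟦ p ⟧ b₀ + (y - b₀) * ⟦ quotient p b₀ ⟧ y  ≈⟨ division p y≈b₀+[y-b₀] ⟨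
      ⟦ p ⟧ y                                    ≈⟨ roots (suc i) ⟩
      0#                                         ∎)
      where
      y = b (suc i)

      y≈b₀+[y-b₀] : y ≈ b₀ + (y - b₀)
      y≈b₀+[y-b₀] = begin
        y               ≈⟨ +-identityʳ y ⟨
        y + 0#          ≈⟨ +-congˡ (-‿inverseˡ b₀) ⟨
        y + (- b₀ + b₀) ≈⟨ +-assoc y (- b₀) b₀ ⟨
        (y - b₀) + b₀   ≈⟨ +-comm (y - b₀) b₀ ⟩
        b₀ + (y - b₀)   ∎

      y-b₀≉0 : y - b₀ ≉ 0#
      y-b₀≉0 eq with () ← b-injective (x∙y⁻¹≈ε⇒x≈y y b₀ eq)

-- Polynomials as functions on the field.

module PointwisePolynomials {c ℓ₁ ℓ₂ q} (𝔽 : FiniteField c ℓ₁ ℓ₂ q) where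
  open FiniteField 𝔽 hiding (zero)
  open FiniteFieldProperties 𝔽
  open PermutationPolynomials 𝔽
  open Inverse enumeration using (to; from; to-cong; strictlyInverseˡ; strictlyInverseʳ)
  open Coefficients commutativeRing
  open ApartnessProperties heytingCommutativeRing using (x-0≈x)
  open AbelianGroupProperties +-abelianGroup using (xyx⁻¹≈y)
  open SemiringExp semiring using (^-congˡ)
  open GroupProperties +-group using (x∙y⁻¹≈ε⇒x≈y; x≈y⇒x∙y⁻¹≈ε)
  open SetoidReasoning setoid
  private
    module S₁ = Substitution {R = 𝔽-raw} commutativeRing
    module S₂ = Substitution {R = 𝔽[x].rawRing} commutativeRing
    module F = RawSemiringDefinitions (RawRing.rawSemiring rawRing)
    module F[x] where
      open RawRing 𝔽[x].rawRing public
      open RawSemiringDefinitions rawSemiring public using (_^_)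
    module F[x,y] where
      open RawRing 𝔽[x,y].rawRing public
      open RawSemiringDefinitions rawSemiring public using (_^_)

    id-homo : IsRingHomomorphism 𝔽-raw rawRing (λ a → a)
    id-homo = Identity.isRingHomomorphism 𝔽-raw refl

  value₂ : BPoly → Carrier → Carrier → Carrier
  value₂ f a b = 𝔽[x,y].substitute 𝔽-raw (λ p → value p a) f b

  value-isRingHomomorphism : ∀ a → IsRingHomomorphism 𝔽[x].rawRing rawRing (λ p → value p a)
  value-isRingHomomorphism = S₁.substitute-isRingHomomorphism id-homo

  value₂-isRingHomomorphism : ∀ a b → IsRingHomomorphism 𝔽[x,y].rawRing rawRing (λ f → value₂ f a b)
  value₂-isRingHomomorphism a = S₂.substitute-isRingHomomorphism (value-isRingHomomorphism a)

  private
    module V a = IsRingHomomorphism (value-isRingHomomorphism a)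
    module V₂ a b = IsRingHomomorphism (value₂-isRingHomomorphism a b)

  infixl 6 _-ₚ_
  _-ₚ_ : UPoly → UPoly → UPoly
  p -ₚ r = p F[x].+ (F[x].- r)

  value-+ : ∀ p r a → value (p F[x].+ r) a ≈ value p a + value r a
  value-+ p r a = V.+-homo a p r

  value-* : ∀ p r a → value (p F[x].* r) a ≈ value p a * value r a
  value-* p r a = V.*-homo a p r

  value-∸ : ∀ p r a → value (p -ₚ r) a ≈ value p a - value r a
  value-∸ p r a = trans (V.+-homo a p (F[x].- r)) (+-congˡ (V.-‿homo a r))

  value-^ : ∀ p n a → value (p F[x].^ n) a ≈ value p a F.^ n
  value-^ p n a = ^-homo 𝔽[x].rawRing commutativeRing (value-isRingHomomorphism a) p n

  value-resp-≈ₚ : ∀ p r → p ≈ₚ r → ∀ a → value p a ≈ value r a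
  value-resp-≈ₚ p r p≈r a = V.⟦⟧-cong a {p} {r} p≈r

  value-const : ∀ a b → value (𝔽[x].const a) b ≈ a
  value-const a b = S₁.substitute-const id-homo b a

  value-x : ∀ a → value x a ≈ a
  value-x = S₁.substitute-X id-homo

  value-cong : ∀ f {a b} → a ≈ b → value f a ≈ value f b
  value-cong = S₁.substitute-cong (λ _ → refl)

  value₂-cong : ∀ f {a a′ b b′} → a ≈ a′ → b ≈ b′ → value₂ f a b ≈ value₂ f a′ b′
  value₂-cong f a≈a′ = S₂.substitute-cong (λ p → value-cong p a≈a′) f

  value-⟨⟩ : ∀ f g a → value (f ⟨ g ⟩) a ≈ value f (value g a)
  value-⟨⟩ f g a = trans
    (S₁.substitute-homo (value-isRingHomomorphism a) f g)
    (S₁.substitute-cong (λ b → value-const b a) f refl)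

  value-⟨,⟩ : ∀ f g₁ g₂ a → value (_⟨_,_⟩ f g₁ g₂) a ≈ value₂ f (value g₁ a) (value g₂ a)
  value-⟨,⟩ f g₁ g₂ a = trans
    (S₂.substitute-homo (value-isRingHomomorphism a) f g₂)
    (S₂.substitute-cong (λ p → value-⟨⟩ p g₁ a) f refl)

  value₂-const : ∀ p a b → value₂ (𝔽[x,y].const p) a b ≈ value p a
  value₂-const p a b = S₂.substitute-const (value-isRingHomomorphism a) b p

  value₂-X : ∀ a b → value₂ X a b ≈ a
  value₂-X a b = trans (value₂-const x a b) (value-x a)

  value₂-Y : ∀ a b → value₂ Y a b ≈ b
  value₂-Y a = S₂.substitute-X (value-isRingHomomorphism a)

  value₂-substitute₁ : ∀ f s a b → value₂ (substitute₁ f s) a b ≈ value f (value₂ s a b)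
  value₂-substitute₁ f s a b = trans
    (S₁.substitute-homo (value₂-isRingHomomorphism a b) f s)
    (S₁.substitute-cong (λ e → trans (value₂-const (𝔽[x].const e) a b) (value-const e a)) f refl)

  value₂-substitute₂ : ∀ f s t a b →
    value₂ (substitute₂ f s t) a b ≈ value₂ f (value₂ s a b) (value₂ t a b)
  value₂-substitute₂ f s t a b = trans
    (S₂.substitute-homo (value₂-isRingHomomorphism a b) f t)
    (S₂.substitute-cong (λ p → value₂-substitute₁ p s a b) f refl)

  value-xq-x : ∀ a → value xq-x a ≈ 0#
  value-xq-x a = begin
    value xq-x a                      ≈⟨ value-∸ (x F[x].^ q) x a ⟩
    value (x F[x].^ q) a - value x a  ≈⟨ +-congʳ (value-^ x q a) ⟩
    value x a F.^ q - value x a       ≈⟨ x≈y⇒x∙y⁻¹≈ε (a^q≈a (value x a)) ⟩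
    0#                                ∎

  value₂-Xq-X : ∀ a b → value₂ Xq-X a b ≈ 0#
  value₂-Xq-X a b = trans (value₂-const xq-x a b) (value-xq-x a)

  value₂-Yq-Y : ∀ a b → value₂ Yq-Y a b ≈ 0#
  value₂-Yq-Y a b = begin
    value₂ Yq-Y a b
      ≈⟨ V₂.+-homo a b (Y F[x,y].^ q) (F[x,y].- Y) ⟩
    value₂ (Y F[x,y].^ q) a b + value₂ (F[x,y].- Y) a b
      ≈⟨ +-cong (^-homo 𝔽[x,y].rawRing commutativeRing (value₂-isRingHomomorphism a b) Y q) (V₂.-‿homo a b Y) ⟩
    value₂ Y a b F.^ q - value₂ Y a b
      ≈⟨ x≈y⇒x∙y⁻¹≈ε (a^q≈a (value₂ Y a b)) ⟩
    0# ∎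

  mod⇒value₂-≈ : ∀ f g → f ≡ g mod[xq-x,yq-y] → ∀ a b → value₂ f a b ≈ value₂ g a b
  mod⇒value₂-≈ f g (u , v , f≈) a b = begin
    value₂ f a b ≈⟨ V₂.⟦⟧-cong a b {f} {g F[x,y].+ (uX F[x,y].+ vY)} f≈ ⟩
    value₂ (g F[x,y].+ (uX F[x,y].+ vY)) a b           ≈⟨ V₂.+-homo a b g (uX F[x,y].+ vY) ⟩
    value₂ g a b + value₂ (uX F[x,y].+ vY) a b         ≈⟨ +-congˡ (V₂.+-homo a b uX vY) ⟩
    value₂ g a b + (value₂ uX a b + value₂ vY a b)
      ≈⟨ +-congˡ (+-cong (multiple≈0 u Xq-X (value₂-Xq-X a b))
                         (multiple≈0 v Yq-Y (value₂-Yq-Y a b))) ⟩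
    value₂ g a b + (0# + 0#)                           ≈⟨ +-congˡ (+-identityˡ 0#) ⟩
    value₂ g a b + 0#                                  ≈⟨ +-identityʳ _ ⟩
    value₂ g a b                                       ∎
    where
    uX = u F[x,y].* Xq-X
    vY = v F[x,y].* Yq-Y

    multiple≈0 : ∀ w z → value₂ z a b ≈ 0# → value₂ (w F[x,y].* z) a b ≈ 0#
    multiple≈0 w z z≈0 = trans (V₂.*-homo a b w z) (trans (*-congˡ z≈0) (zeroʳ _))

  -- Reduction modulo x^q - x, and recovery of coefficients from values.

  Degree<q : UPoly → Set ℓ₁
  Degree<q p = ∀ i → q ℕ.≤ i → 𝔽[x].coeff p i ≈ 0#

  value-reduce : ∀ p a → value (reduce p) a ≈ value p a
  value-reduce []      a = refl
  value-reduce (b ∷ p) a = begin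
    value (s -ₚ t F[x].* xq-x) a             ≈⟨ value-∸ s (t F[x].* xq-x) a ⟩
    value s a - value (t F[x].* xq-x) a      ≈⟨ +-congˡ (-‿cong (value-* t xq-x a)) ⟩
    value s a - value t a * value xq-x a
      ≈⟨ +-congˡ (-‿cong (trans (*-congˡ (value-xq-x a)) (zeroʳ _))) ⟩
    value s a - 0#                           ≈⟨ x-0≈x _ ⟩
    value s a                                ≈⟨ +-congˡ (*-congˡ (value-reduce p a)) ⟩
    value (b ∷ p) a                          ∎
    where
    s = b ∷ reduce p
    t = 𝔽[x].const (𝔽[x].coeff s q)

  degree-x : Degree<q x
  degree-x i q≤i with s≤s (s≤s _) ← ℕ.≤-trans 1<q q≤i = refl

  coeff-xq-x-q : 𝔽[x].coeff xq-x q ≈ 1#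
  coeff-xq-x-q = begin
    𝔽[x].coeff xq-x q                            ≈⟨ coeff-∸ (x F[x].^ q) x q ⟩
    𝔽[x].coeff (x F[x].^ q) q - 𝔽[x].coeff x q
      -- The subtracted x does not disturb the leading coefficient, since 1 < q.
      ≈⟨ +-cong (coeff-X^n-n q) (-‿cong (degree-x q ℕ.≤-refl)) ⟩
    1# - 0#                                      ≈⟨ x-0≈x 1# ⟩
    1#                                           ∎

  coeff-xq-x-> : ∀ {i} → q ℕ.< i → 𝔽[x].coeff xq-x i ≈ 0#
  coeff-xq-x-> {i} q<i = begin
    𝔽[x].coeff xq-x i                            ≈⟨ coeff-∸ (x F[x].^ q) x i ⟩
    𝔽[x].coeff (x F[x].^ q) i - 𝔽[x].coeff x i
      ≈⟨ +-cong (coeff-X^n-> q q<i) (-‿cong (degree-x i (ℕ.<⇒≤ q<i))) ⟩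
    0# - 0#                                      ≈⟨ -‿inverseʳ 0# ⟩
    0#                                           ∎

  -- Inductively `reduce p` has degree below q, so `s` has degree at most q. Subtracting `t` times
  -- the monic x^q - x cancels the coefficient at q and changes nothing above it.
  degree-reduce : ∀ p → Degree<q (reduce p)
  degree-reduce []      i q≤i = refl
  degree-reduce (b ∷ p) i q≤i = begin
    𝔽[x].coeff (s -ₚ 𝔽[x].const t F[x].* xq-x) i
                                               ≈⟨ coeff-∸ s (𝔽[x].const t F[x].* xq-x) i ⟩
    𝔽[x].coeff s i - 𝔽[x].coeff (𝔽[x].const t F[x].* xq-x) i
                                               ≈⟨ +-congˡ (-‿cong (coeff-const-* t xq-x i)) ⟩
    𝔽[x].coeff s i - t * 𝔽[x].coeff xq-x i     ≈⟨ x≈y⇒x∙y⁻¹≈ε (cancels (ℕ.m≤n⇒m<n∨m≡n q≤i)) ⟩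
    0#                                         ∎
    where
    s = b ∷ reduce p
    t = 𝔽[x].coeff s q

    degree-s : ∀ {i} → q ℕ.< i → 𝔽[x].coeff s i ≈ 0#
    degree-s {suc i} (s≤s q≤i) = degree-reduce p i q≤i

    cancels : (q ℕ.< i) ⊎ (q ≡ i) → 𝔽[x].coeff s i ≈ t * 𝔽[x].coeff xq-x i
    cancels (inj₁ q<i)    = trans (degree-s q<i) (sym (trans (*-congˡ (coeff-xq-x-> q<i)) (zeroʳ t)))
    cancels (inj₂ ≡.refl) = sym (trans (*-congˡ coeff-xq-x-q) (*-identityʳ t))

  -- The difference has degree below q and vanishes at the q points of the enumeration.
  values-determine : ∀ p r → Degree<q p → Degree<q r → (∀ a → value p a ≈ value r a) → p ≈ₚ r
  values-determine p r deg-p deg-r p≈r i =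
    x∙y⁻¹≈ε⇒x≈y _ _ (trans (sym (coeff-∸ p r i))
      (all-roots⇒≈0 from from-injective (p -ₚ r) deg-p-r roots i))
    where
    from-injective : ∀ {i j} → from i ≈ from j → i ≡ j
    from-injective {i} {j} eq = ≡.trans (≡.sym (strictlyInverseˡ i)) (≡.trans (to-cong eq) (strictlyInverseˡ j))

    deg-p-r : Degree<q (p -ₚ r)
    deg-p-r i q≤i = trans (coeff-∸ p r i) (x≈y⇒x∙y⁻¹≈ε (trans (deg-p i q≤i) (sym (deg-r i q≤i))))

    roots : ∀ i → value (p -ₚ r) (from i) ≈ 0#
    roots i = trans (value-∸ p r (from i)) (x≈y⇒x∙y⁻¹≈ε (p≈r (from i)))

  -- Interpolation.

  -- The indicator function of b, as 1 − (x − b)^(q-1).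
  δ : Carrier → UPoly
  δ b = F[x].1# -ₚ (x -ₚ 𝔽[x].const b) F[x].^ ℕ.pred q

  value-δ : ∀ a b → value (δ b) a ≈ 1# - (a - b) F.^ ℕ.pred q
  value-δ a b = begin
    value (δ b) a                                         ≈⟨ value-∸ F[x].1# (x-b F[x].^ ℕ.pred q) a ⟩
    value F[x].1# a - value (x-b F[x].^ ℕ.pred q) a
      ≈⟨ +-cong (value-const 1# a) (-‿cong (value-^ x-b (ℕ.pred q) a)) ⟩
    1# - value x-b a F.^ ℕ.pred q
      ≈⟨ +-congˡ (-‿cong (^-congˡ (ℕ.pred q) value-x-b)) ⟩
    1# - (a - b) F.^ ℕ.pred q                             ∎
    where
    x-b = x -ₚ 𝔽[x].const b

    value-x-b : value x-b a ≈ a - b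
    value-x-b = trans (value-∸ x (𝔽[x].const b) a) (+-cong (value-x a) (-‿cong (value-const b a)))

  value-δ-≈ : ∀ {a b} → a ≈ b → value (δ b) a ≈ 1#
  value-δ-≈ {a} {b} a≈b = begin
    value (δ b) a              ≈⟨ value-δ a b ⟩
    1# - (a - b) F.^ ℕ.pred q  ≈⟨ +-congˡ (-‿cong (0^n 1<q)) ⟩
    1# - 0#                    ≈⟨ x-0≈x 1# ⟩
    1#                         ∎
    where
    0^n : ∀ {n} → 1 ℕ.< n → (a - b) F.^ ℕ.pred n ≈ 0#
    -- The bound 1 < n makes the exponent a successor; exponent 0 would give 1 instead.
    0^n (s≤s (s≤s _)) = trans (*-congʳ (x≈y⇒x∙y⁻¹≈ε a≈b)) (zeroˡ _)

  value-δ-≉ : ∀ {a b} → a ≉ b → value (δ b) a ≈ 0#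
  value-δ-≉ {a} {b} a≉b = trans (value-δ a b)
    (x≈y⇒x∙y⁻¹≈ε (sym (fermat (a≉b ∘ x∙y⁻¹≈ε⇒x≈y a b))))

  -- Points are added one at a time. The degree is left unbounded, to be lowered afterwards by
  -- `reduce`.
  interpolate : (φ : Carrier → Carrier) → (∀ {a b} → a ≈ b → φ a ≈ φ b) →
                ∀ {n} (b : Fin n → Carrier) → ∃[ p ] (∀ i → value p (b i) ≈ φ (b i))
  interpolate φ φ-cong {zero}  b = [] , λ ()
  interpolate φ φ-cong {suc n} b with interpolate φ φ-cong (b ∘ suc)
  ... | p , p≈φ = p′ , p′≈φ
    where
    b₀ = b zero
    -- The correction is the error of `p` at `b₀`, switched on by the indicator at `b₀` only.
    p′ = p F[x].+ δ b₀ F[x].* (𝔽[x].const (φ b₀) -ₚ p)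

    value-p′ : ∀ a → value p′ a ≈ value p a + value (δ b₀) a * (φ b₀ - value p a)
    value-p′ a = begin
      value p′ a
        ≈⟨ value-+ p (δ b₀ F[x].* (𝔽[x].const (φ b₀) -ₚ p)) a ⟩
      value p a + value (δ b₀ F[x].* (𝔽[x].const (φ b₀) -ₚ p)) a
        ≈⟨ +-congˡ (value-* (δ b₀) (𝔽[x].const (φ b₀) -ₚ p) a) ⟩
      value p a + value (δ b₀) a * value (𝔽[x].const (φ b₀) -ₚ p) a
        ≈⟨ +-congˡ (*-congˡ (value-∸ (𝔽[x].const (φ b₀)) p a)) ⟩
      value p a + value (δ b₀) a * (value (𝔽[x].const (φ b₀)) a - value p a)
        ≈⟨ +-congˡ (*-congˡ (+-congʳ (value-const (φ b₀) a))) ⟩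
      value p a + value (δ b₀) a * (φ b₀ - value p a) ∎

    at-b₀ : ∀ {a} → a ≈ b₀ → value p′ a ≈ φ a
    at-b₀ {a} a≈b₀ = begin
      value p′ a                                        ≈⟨ value-p′ a ⟩
      value p a + value (δ b₀) a * (φ b₀ - value p a)
        ≈⟨ +-congˡ (trans (*-congʳ (value-δ-≈ a≈b₀)) (*-identityˡ _)) ⟩
      value p a + (φ b₀ - value p a)                    ≈⟨ +-assoc _ _ _ ⟨
      (value p a + φ b₀) - value p a                    ≈⟨ xyx⁻¹≈y (value p a) (φ b₀) ⟩
      φ b₀                                              ≈⟨ φ-cong a≈b₀ ⟨
      φ a                                               ∎

    away-from-b₀ : ∀ {a} → a ≉ b₀ → value p′ a ≈ value p a
    away-from-b₀ {a} a≉b₀ = begin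
      value p′ a                                        ≈⟨ value-p′ a ⟩
      value p a + value (δ b₀) a * (φ b₀ - value p a)
        ≈⟨ +-congˡ (trans (*-congʳ (value-δ-≉ a≉b₀)) (zeroˡ _)) ⟩
      value p a + 0#                                    ≈⟨ +-identityʳ _ ⟩
      value p a                                         ∎

    p′≈φ : ∀ i → value p′ (b i) ≈ φ (b i)
    p′≈φ zero = at-b₀ refl
    -- The points are allowed to coincide; one that equals `b₀` gets its value through `φ-cong`.
    p′≈φ (suc i) with b (suc i) ≟ b₀
    ... | yes ≈b₀ = at-b₀ ≈b₀
    ... | no  ≉b₀ = trans (away-from-b₀ ≉b₀) (p≈φ i)

  -- Composition, inverse polynomials and complete mappings.

  value-∙ : ∀ f g a → value (f ∙ g) a ≈ value f (value g a)
  value-∙ f g a = trans (value-reduce (f ⟨ g ⟩) a) (value-⟨⟩ f g a)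

  value-⊙ : ∀ f g a → value (⊙ f x g) a ≈ value₂ f a (value g a)
  value-⊙ f g a = trans (value-reduce (_⟨_,_⟩ f x g) a)
    (trans (value-⟨,⟩ f x g a) (value₂-cong f (value-x a) refl))

  Bijective-resp : ∀ {φ ψ : Carrier → Carrier} → (∀ a → φ a ≈ ψ a) →
                   Bijective _≈_ _≈_ φ → Bijective _≈_ _≈_ ψ
  Bijective-resp φ≈ψ (φ-injective , φ-surjective) =
    (λ ψa≈ψb → φ-injective (trans (φ≈ψ _) (trans ψa≈ψb (sym (φ≈ψ _))))) ,
    (λ b → let a , φ≈b = φ-surjective b in a , λ z≈a → trans (sym (φ≈ψ _)) (φ≈b z≈a))

  inverses⇒bijective : ∀ {φ ψ : Carrier → Carrier} →
    (∀ {a b} → a ≈ b → φ a ≈ φ b) → (∀ {a b} → a ≈ b → ψ a ≈ ψ b) →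
    (∀ a → ψ (φ a) ≈ a) → (∀ a → φ (ψ a) ≈ a) → Bijective _≈_ _≈_ φ
  inverses⇒bijective {φ} {ψ} φ-cong ψ-cong ψφ≈id φψ≈id =
    (λ φa≈φb → trans (sym (ψφ≈id _)) (trans (ψ-cong φa≈φb) (ψφ≈id _))) ,
    (λ b → ψ b , λ z≈ψb → trans (φ-cong z≈ψb) (φψ≈id b))

  ∙-∈𝒫 : ∀ f g → f ∈ 𝒫 → g ∈ 𝒫 → f ∙ g ∈ 𝒫
  ∙-∈𝒫 f g (_ , f-perm) (_ , g-perm) =
    degree-reduce (f ⟨ g ⟩) ,
    Bijective-resp (λ a → sym (value-∙ f g a)) (Composition.bijective _≈_ _≈_ _≈_ g-perm f-perm)

  inverse-polynomial : ∀ f → f ∈ 𝒫 → ∃[ f⁻¹ ] IsInverseOf f⁻¹ f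
  inverse-polynomial f (_ , f-injective , f-surjective) = f⁻¹ ,
    (degree-reduce p , inverses⇒bijective (value-cong f⁻¹) (value-cong f) ff⁻¹≈id f⁻¹f≈id) ,
    identity f⁻¹ f f⁻¹f≈id ,
    identity f f⁻¹ ff⁻¹≈id
    where
    φ : Carrier → Carrier
    φ b = proj₁ (f-surjective b)

    fφ≈id : ∀ b → value f (φ b) ≈ b
    fφ≈id b = proj₂ (f-surjective b) refl

    -- The preimages picked by surjectivity might depend on the representative of a point;
    -- injectivity of `f` rules this out.
    φ-cong : ∀ {a b} → a ≈ b → φ a ≈ φ b
    φ-cong {a} {b} a≈b = f-injective (trans (fφ≈id a) (trans a≈b (sym (fφ≈id b))))

    p = proj₁ (interpolate φ φ-cong from)
    f⁻¹ = reduce p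

    f⁻¹≈φ : ∀ b → value f⁻¹ b ≈ φ b
    f⁻¹≈φ b = begin
      value f⁻¹ b           ≈⟨ value-reduce p b ⟩
      value p b             ≈⟨ value-cong p (strictlyInverseʳ b) ⟨
      value p (from (to b)) ≈⟨ proj₂ (interpolate φ φ-cong from) (to b) ⟩
      φ (from (to b))       ≈⟨ φ-cong (strictlyInverseʳ b) ⟩
      φ b                   ∎

    ff⁻¹≈id : ∀ b → value f (value f⁻¹ b) ≈ b
    ff⁻¹≈id b = trans (value-cong f (f⁻¹≈φ b)) (fφ≈id b)

    f⁻¹f≈id : ∀ a → value f⁻¹ (value f a) ≈ a
    f⁻¹f≈id a = f-injective (ff⁻¹≈id (value f a))

    identity : ∀ g h → (∀ a → value g (value h a) ≈ a) → g ∙ h ≈ₚ x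
    identity g h gh≈id = values-determine (g ∙ h) x (degree-reduce (g ⟨ h ⟩)) degree-x
      (λ a → trans (value-∙ g h a) (trans (gh≈id a) (sym (value-x a))))

  module InversePolynomial f (f∈𝒫 : f ∈ 𝒫) where
    f⁻¹ : UPoly
    f⁻¹ = proj₁ (inverse-polynomial f f∈𝒫)

    isInverseOf : IsInverseOf f⁻¹ f
    isInverseOf = proj₂ (inverse-polynomial f f∈𝒫)

    f⁻¹∈𝒫 : f⁻¹ ∈ 𝒫
    f⁻¹∈𝒫 = proj₁ isInverseOf

    private
      pointwise : ∀ g h → g ∙ h ≈ₚ x → ∀ a → value g (value h a) ≈ a
      pointwise g h gh≈x a = trans (sym (value-∙ g h a))
        (trans (value-resp-≈ₚ (g ∙ h) x gh≈x a) (value-x a))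

    inverseˡ : ∀ a → value f⁻¹ (value f a) ≈ a
    inverseˡ = pointwise f⁻¹ f (proj₁ (proj₂ isInverseOf))

    inverseʳ : ∀ a → value f (value f⁻¹ a) ≈ a
    inverseʳ = pointwise f f⁻¹ (proj₂ (proj₂ isInverseOf))

  ⊙-permutation : ∀ f g → IsCompleteMapping f g → Bijective _≈_ _≈_ (λ a → value₂ f a (value g a))
  ⊙-permutation f g (_ , _ , perm) = Bijective-resp (value-⊙ f g) perm

  -- The degree bound on `⊙ f x g` is supplied by the final `reduce`, so for g in 𝒫 completeness is
  -- exactly bijectivity of a ↦ f(a, g a).
  complete : ∀ f g → g ∈ 𝒫 → Bijective _≈_ _≈_ (λ a → value₂ f a (value g a)) → IsCompleteMapping f g
  complete f g g∈𝒫 perm = g∈𝒫 , degree-reduce (_⟨_,_⟩ f x g) ,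
    Bijective-resp (λ a → sym (value-⊙ f g a)) perm

  -- Needed for surjectivity, where conjugating back and forth returns the given mapping only up to
  -- `_≈ₚ_`.
  IsCompleteMapping-resp : ∀ f g g′ → g′ ∈ 𝒫 → g ≈ₚ g′ → IsCompleteMapping f g → IsCompleteMapping f g′
  IsCompleteMapping-resp f g g′ g′∈𝒫 g≈g′ g-complete = complete f g′ g′∈𝒫
    (Bijective-resp (λ a → value₂-cong f refl (value-resp-≈ₚ g g′ g≈g′ a)) (⊙-permutation f g g-complete))

  -- Conjugation by an isotopism.

  module Conjugation f₁ f₂ h₁ h₂ h₃ (isotopism : IsIsotopism f₁ f₂ h₁ h₂ h₃) where
    open IsIsotopism isotopism
    open InversePolynomial h₁ h₁∈𝒫 public using () renaming
      (f⁻¹ to h₁⁻¹; isInverseOf to h₁⁻¹-isInverseOf; f⁻¹∈𝒫 to h₁⁻¹∈𝒫; inverseˡ to inverseˡ₁; inverseʳ to inverseʳ₁)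
    open InversePolynomial h₂ h₂∈𝒫 using () renaming (f⁻¹ to h₂⁻¹; f⁻¹∈𝒫 to h₂⁻¹∈𝒫; inverseʳ to inverseʳ₂)
    open InversePolynomial h₃ h₃∈𝒫 using () renaming (f⁻¹ to h₃⁻¹; f⁻¹∈𝒫 to h₃⁻¹∈𝒫; inverseˡ to inverseˡ₃)

    value₂-isotopic : ∀ a b → value₂ f₂ (value h₁ a) (value h₂ b) ≈ value h₃ (value₂ f₁ a b)
    value₂-isotopic a b = begin
      value₂ f₂ (value h₁ a) (value h₂ b)
        ≈⟨ value₂-cong f₂ (trans (value₂-substitute₁ h₁ X a b) (value-cong h₁ (value₂-X a b)))
                          (trans (value₂-substitute₁ h₂ Y a b) (value-cong h₂ (value₂-Y a b))) ⟨
      value₂ f₂ (value₂ h₁X a b) (value₂ h₂Y a b)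
        ≈⟨ value₂-substitute₂ f₂ h₁X h₂Y a b ⟨
      value₂ (substitute₂ f₂ h₁X h₂Y) a b
        ≈⟨ mod⇒value₂-≈ (substitute₂ f₂ h₁X h₂Y) (substitute₁ h₃ f₁) isotopic a b ⟩
      value₂ (substitute₁ h₃ f₁) a b
        ≈⟨ value₂-substitute₁ h₃ f₁ a b ⟩
      value h₃ (value₂ f₁ a b) ∎
      where
      h₁X = substitute₁ h₁ X
      h₂Y = substitute₁ h₂ Y

    conjugate : UPoly → UPoly
    conjugate g = h₂ ∙ g ∙ h₁⁻¹

    conjugate-∈𝒫 : ∀ g → g ∈ 𝒫 → conjugate g ∈ 𝒫
    conjugate-∈𝒫 g g∈𝒫 = ∙-∈𝒫 (h₂ ∙ g) h₁⁻¹ (∙-∈𝒫 h₂ g h₂∈𝒫 g∈𝒫) h₁⁻¹∈𝒫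

    value-conjugate : ∀ g a → value (conjugate g) a ≈ value h₂ (value g (value h₁⁻¹ a))
    value-conjugate g a = trans (value-∙ (h₂ ∙ g) h₁⁻¹ a) (value-∙ h₂ g (value h₁⁻¹ a))

    value-conjugate-h₁ : ∀ g a → value (conjugate g) (value h₁ a) ≈ value h₂ (value g a)
    value-conjugate-h₁ g a = trans (value-conjugate g (value h₁ a))
      (value-cong h₂ (value-cong g (inverseˡ₁ a)))

    value₂-conjugate : ∀ g a →
      value₂ f₂ (value h₁ a) (value (conjugate g) (value h₁ a)) ≈ value h₃ (value₂ f₁ a (value g a))
    value₂-conjugate g a =
      trans (value₂-cong f₂ refl (value-conjugate-h₁ g a)) (value₂-isotopic a (value g a))

    conjugate-complete : ∀ g → g ∈ 𝒫 → IsCompleteMapping f₁ g ⇔ IsCompleteMapping f₂ (conjugate g)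
    conjugate-complete g g∈𝒫 = mk⇔
      -- Writing F₁ and F₂ for the maps a ↦ f₁(a, g a) and a ↦ f₂(a, g′ a), with g′ the conjugate of
      -- g, this is F₂ = h₃ F₁ h₁⁻¹.
      (λ g-complete → complete f₂ (conjugate g) (conjugate-∈𝒫 g g∈𝒫) (Bijective-resp
        (λ a → trans (sym (value₂-conjugate g (value h₁⁻¹ a)))
          (value₂-cong f₂ (inverseʳ₁ a) (value-cong (conjugate g) (inverseʳ₁ a))))
        (bijective (proj₂ h₁⁻¹∈𝒫) (bijective (⊙-permutation f₁ g g-complete) (proj₂ h₃∈𝒫)))))
      -- The same identity solved for the other map: F₁ = h₃⁻¹ F₂ h₁.
      (λ g′-complete → complete f₁ g g∈𝒫 (Bijective-resp
        (λ a → trans (value-cong h₃⁻¹ (value₂-conjugate g a)) (inverseˡ₃ _))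
        (bijective (proj₂ h₁∈𝒫) (bijective (⊙-permutation f₂ (conjugate g) g′-complete) (proj₂ h₃⁻¹∈𝒫)))))
      where bijective = Composition.bijective _≈_ _≈_ _≈_

    conjugate-cong : ∀ g g′ → g ≈ₚ g′ → conjugate g ≈ₚ conjugate g′
    conjugate-cong g g′ g≈g′ = values-determine (conjugate g) (conjugate g′)
      (degree-reduce ((h₂ ∙ g) ⟨ h₁⁻¹ ⟩)) (degree-reduce ((h₂ ∙ g′) ⟨ h₁⁻¹ ⟩)) λ a → begin
        value (conjugate g) a                ≈⟨ value-conjugate g a ⟩
        value h₂ (value g (value h₁⁻¹ a))    ≈⟨ value-cong h₂ (value-resp-≈ₚ g g′ g≈g′ _) ⟩
        value h₂ (value g′ (value h₁⁻¹ a))   ≈⟨ value-conjugate g′ a ⟨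
        value (conjugate g′) a               ∎

    -- Comparing the conjugates at `h₁ a` leaves only `h₂` to be cancelled.
    conjugate-injective : ∀ g g′ → g ∈ 𝒫 → g′ ∈ 𝒫 → conjugate g ≈ₚ conjugate g′ → g ≈ₚ g′
    conjugate-injective g g′ (deg , _) (deg′ , _) eq = values-determine g g′ deg deg′ λ a →
      proj₁ (proj₂ h₂∈𝒫) (begin
        value h₂ (value g a)                ≈⟨ value-conjugate-h₁ g a ⟨
        value (conjugate g) (value h₁ a)    ≈⟨ value-resp-≈ₚ (conjugate g) (conjugate g′) eq _ ⟩
        value (conjugate g′) (value h₁ a)   ≈⟨ value-conjugate-h₁ g′ a ⟩
        value h₂ (value g′ a)               ∎)

    unconjugate : UPoly → UPoly
    unconjugate g = h₂⁻¹ ∙ g ∙ h₁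

    unconjugate-∈𝒫 : ∀ g → g ∈ 𝒫 → unconjugate g ∈ 𝒫
    unconjugate-∈𝒫 g g∈𝒫 = ∙-∈𝒫 (h₂⁻¹ ∙ g) h₁ (∙-∈𝒫 h₂⁻¹ g h₂⁻¹∈𝒫 g∈𝒫) h₁∈𝒫

    conjugate-unconjugate : ∀ g → g ∈ 𝒫 → conjugate (unconjugate g) ≈ₚ g
    conjugate-unconjugate g (deg , _) = values-determine (conjugate (unconjugate g)) g
      (degree-reduce ((h₂ ∙ unconjugate g) ⟨ h₁⁻¹ ⟩)) deg λ a → begin
        value (conjugate (unconjugate g)) a                   ≈⟨ value-conjugate (unconjugate g) a ⟩
        value h₂ (value (unconjugate g) (value h₁⁻¹ a))
          ≈⟨ value-cong h₂ (value-∙ (h₂⁻¹ ∙ g) h₁ _) ⟩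
        value h₂ (value (h₂⁻¹ ∙ g) (value h₁ (value h₁⁻¹ a)))
          ≈⟨ value-cong h₂ (value-cong (h₂⁻¹ ∙ g) (inverseʳ₁ a)) ⟩
        value h₂ (value (h₂⁻¹ ∙ g) a)                         ≈⟨ value-cong h₂ (value-∙ h₂⁻¹ g a) ⟩
        value h₂ (value h₂⁻¹ (value g a))                     ≈⟨ inverseʳ₂ (value g a) ⟩
        value g a                                             ∎

    conjugation : Bijection (CompleteMappings f₁) (CompleteMappings f₂)
    conjugation = record
      { to        = λ (g , g-complete) →
          conjugate g , Equivalence.to (conjugate-complete g (proj₁ g-complete)) g-complete
      ; cong      = λ {(g , _)} {(g′ , _)} → conjugate-cong g g′
      ; bijective =
          (λ {(g , g∈𝒫 , _)} {(g′ , g′∈𝒫 , _)} → conjugate-injective g g′ g∈𝒫 g′∈𝒫) ,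
          surjective
      }
      where
      surjective : ∀ ((g′ , _) : ∃[ g′ ] IsCompleteMapping f₂ g′) →
                   ∃[ g ] (∀ {z : ∃[ z ] IsCompleteMapping f₁ z} → proj₁ z ≈ₚ proj₁ g → conjugate (proj₁ z) ≈ₚ g′)
      surjective (g′ , g′-complete@(g′∈𝒫 , _)) =
        -- The preimage is complete by the converse half of the equivalence, once completeness of
        -- `g′` is transported to the conjugate of `g`.
        (g , Equivalence.from (conjugate-complete g g∈𝒫)
               (IsCompleteMapping-resp f₂ g′ (conjugate g) (conjugate-∈𝒫 g g∈𝒫) (λ i → sym (cg≈g′ i)) g′-complete)) ,
        λ {z} z≈g i → trans (conjugate-cong (proj₁ z) g z≈g i) (cg≈g′ i)
        where
        g     = unconjugate g′
        g∈𝒫   = unconjugate-∈𝒫 g′ g′∈𝒫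
        cg≈g′ = conjugate-unconjugate g′ g′∈𝒫

proposition5p1 : ∀ {c ℓ₁ ℓ₂} (q : ℕ) → IsPrimePower q → (𝔽 : FiniteField c ℓ₁ ℓ₂ q) →
    let open PermutationPolynomials 𝔽 in
    (f₁ f₂ : BPoly) → f₁ ∈ ℒ𝒫 → f₂ ∈ ℒ𝒫 →
    (Isotopic f₁ f₂ → Bijection (CompleteMappings f₁) (CompleteMappings f₂)) ×
    (∀ h₁ h₂ h₃ → IsIsotopism f₁ f₂ h₁ h₂ h₃ →
    Σ[ h₁⁻¹ ∈ UPoly ]
    IsInverseOf h₁⁻¹ h₁ ×
    (∀ g → g ∈ 𝒫 →
    h₂ ∙ g ∙ h₁⁻¹ ∈ 𝒫 ×
    (IsCompleteMapping f₁ g ⇔ IsCompleteMapping f₂ (h₂ ∙ g ∙ h₁⁻¹))) ×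
    (Σ[ φ ∈ Bijection (CompleteMappings f₁) (CompleteMappings f₂) ]
    (∀ g → proj₁ (Bijection.to φ g) ≈ₚ h₂ ∙ proj₁ g ∙ h₁⁻¹)))
proposition5p1 q _ 𝔽 f₁ f₂ _ _ =
  (λ (h₁ , h₂ , h₃ , isotopism) → Conjugation.conjugation f₁ f₂ h₁ h₂ h₃ isotopism) ,
  λ h₁ h₂ h₃ isotopism → let open Conjugation f₁ f₂ h₁ h₂ h₃ isotopism in
    h₁⁻¹ ,
    h₁⁻¹-isInverseOf ,
    (λ g g∈𝒫 → conjugate-∈𝒫 g g∈𝒫 , conjugate-complete g g∈𝒫) ,
    conjugation , λ g i → FiniteField.refl 𝔽
  where
  open PointwisePolynomials 𝔽
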